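{- There exists a unique algebra homomorphism $\widetilde{\natural}:\mathcal H_q\to\mathfrak{W}_q$ sending $A\mapsto K_2^{ -1}$, $B\mapsto \widetilde\Lambda$, $C\mapsto IK_1^{ -1}-q(q-q^{ -1})^2E_1F_2K_2^{ -1}$, where $\widetilde\Lambda=(q-q^{ -1})^2(E_1+K_1^{ -1}E_2)(F_1K_2+F_2)+q^{ -1}K_1K_2+qK_1^{ -1}K_2^{ -1}$. Moreover $\widetilde\natural$ sends $\alpha\mapsto \Lambda_2+\Lambda_1K_1^{ -1}K_2^{ -1}$, $\beta\mapsto IK_1^{ -1}K_2^{ -1}$, $\gamma\mapsto\Lambda_1+\Lambda_2K_1^{ -1}K_2^{ -1}$.
   Context: $q$ is a nonzero complex number which is not a root of unity; $[x,y]=xy-yx$, $[x,y]_q=qxy-q^{ -1}yx$; algebras are unital associative over $\mathbb C$. The universal $q$-Hahn algebra $\mathcal H_q$ is generated by $A,B,C$ subject to the relations that each of $\frac{[B,C]_q}{q^2-q^{ -2}}+A$, $[C,A]_q$, $\frac{[A,B]_q}{q^2-q^{ -2}}+C$ commutes with $A,B,C$. Set $\alpha=\frac{[B,C]_q}{q-q^{ -1}}+(q+q^{ -1})A$, $\beta=\frac{[C,A]_q}{q-q^{ -1}}$, $\gamma=\frac{[A,B]_q}{q-q^{ -1}}+(q+q^{ -1})C$. $\mathfrak{W}_q$ is generated by $E_1,E_2,F_1,F_2,K_1^{\pm1},K_2^{\pm1},I^{\pm1}$ with relations: $I$ central; $II^{ -1}=I^{ -1}I=1$, $K_iK_i^{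 -1}=K_i^{ -1}K_i=1$ ($i=1,2$); $[K_1,E_2]=[K_1,F_2]=[K_1,K_2]=[K_2,E_1]=[K_2,F_1]=0$; $[E_1,K_1]_q=[K_1,F_1]_q=[E_2,K_2]_q=[K_2,F_2]_q=0$; $[E_1,E_2]=[E_1,F_2]=[F_1,E_2]=[F_1,F_2]=0$; $[E_1,F_1]=\frac{K_1-IK_1^{ -1}}{q-q^{ -1}}$; $[E_2,F_2]=\frac{IK_2-K_2^{ -1}}{q-q^{ -1}}$. $\Lambda_1=(q-q^{ -1})^2E_1F_1+q^{ -1}K_1+qIK_1^{ -1}$ and $\Lambda_2=(q-q^{ -1})^2E_2F_2+q^{ -1}IK_2+qK_2^{ -1}$ in $\mathfrak W_q$. (The element $\widetilde\Lambda$ is the image of the Casimir element $(q-q^{ -1})^2EF+q^{ -1}K+qK^{ -1}$ of $U_q(\mathfrak{sl}_2)$ under the homomorphism $E\mapsto E_1+K_1^{ -1}E_2$, $F\mapsto F_1K_2+F_2$, $K^{\pm1}\mapsto K_1^{\pm1}K_2^{\pm1}$.) -}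

module Defs where

open import Level using (Level; _⊔_) renaming (suc to lsuc)
open import Algebra.Bundles using (CommutativeRing)
open import Relation.Nullary using (¬_)
open import Data.Nat using (ℕ; zero; suc)

record Field (c ℓ : Level) : Set (lsuc (c ⊔ ℓ)) where
  field
    commutativeRing : CommutativeRing c ℓ
  open CommutativeRing commutativeRing public
  field
    _⁻¹        : Carrier → Carrier
    ⁻¹-inverse : ∀ x → ¬ (x ≈ 0#) → x * (x ⁻¹) ≈ 1#
    0≉1        : ¬ (0# ≈ 1#)
  infix 8 _⁻¹

module _ {c ℓ} (F : Field c ℓ) where
  open Field F

  pow : Carrier → ℕ → Carrier
  pow x zero    = 1#
  pow x (suc n) = x * pow x n

  natC : ℕ → Carrier
  natC zero    = 0#
  natC (suc n) = 1# + natC n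

  NotRootOfUnity : Carrier → Set ℓ
  NotRootOfUnity q = ∀ n → ¬ (pow q (suc n) ≈ 1#)

  CharacteristicZero : Set ℓ
  CharacteristicZero = ∀ n → ¬ (natC (suc n) ≈ 0#)

-- Unital associative algebras over a commutative ring R presented by
-- generators X and relations Rel: terms of the free algebra modulo the
-- congruence generated by the algebra axioms and Rel.

module FreeAlgebra {c ℓ} (R : CommutativeRing c ℓ) where
  open CommutativeRing R using (Carrier; _≈_; _+_; _*_; -_; 0#; 1#)

  infixl 6 _⊕_
  infixl 7 _⊗_

  data Term (X : Set) : Set c where
    gen : X → Term X
    sc  : Carrier → Term X
    _⊕_ : Term X → Term X → Term X
    _⊗_ : Term X → Term X → Term X

  module _ {X : Set} where
    infixl 6 _⊖_
    ⊖_ : Term X → Term X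
    ⊖ t = sc (- 1#) ⊗ t

    _⊖_ : Term X → Term X → Term X
    s ⊖ t = s ⊕ ⊖ t

    ⟦_,_⟧ : Term X → Term X → Term X
    ⟦ x , y ⟧ = x ⊗ y ⊖ y ⊗ x

  data Eq {X : Set} (Rel : Term X → Term X → Set) : Term X → Term X → Set (c ⊔ ℓ) where
    rel      : ∀ {s t} → Rel s t → Eq Rel s t
    refl′    : ∀ {s} → Eq Rel s s
    sym′     : ∀ {s t} → Eq Rel s t → Eq Rel t s
    trans′   : ∀ {s t u} → Eq Rel s t → Eq Rel t u → Eq Rel s u
    ⊕-cong   : ∀ {s s′ t t′} → Eq Rel s s′ → Eq Rel t t′ → Eq Rel (s ⊕ t) (s′ ⊕ t′)
    ⊗-cong   : ∀ {s s′ t t′} → Eq Rel s s′ → Eq Rel t t′ → Eq Rel (s ⊗ t) (s′ ⊗ t′)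
    sc-cong  : ∀ {a b} → a ≈ b → Eq Rel (sc a) (sc b)
    ⊕-assoc  : ∀ s t u → Eq Rel ((s ⊕ t) ⊕ u) (s ⊕ (t ⊕ u))
    ⊕-comm   : ∀ s t → Eq Rel (s ⊕ t) (t ⊕ s)
    ⊕-idˡ    : ∀ t → Eq Rel (sc 0# ⊕ t) t
    ⊕-inv    : ∀ t → Eq Rel (t ⊕ (sc (- 1#) ⊗ t)) (sc 0#)
    ⊗-assoc  : ∀ s t u → Eq Rel ((s ⊗ t) ⊗ u) (s ⊗ (t ⊗ u))
    ⊗-idˡ    : ∀ t → Eq Rel (sc 1# ⊗ t) t
    ⊗-idʳ    : ∀ t → Eq Rel (t ⊗ sc 1#) t
    distribˡ : ∀ s t u → Eq Rel (s ⊗ (t ⊕ u)) ((s ⊗ t) ⊕ (s ⊗ u))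
    distribʳ : ∀ s t u → Eq Rel ((t ⊕ u) ⊗ s) ((t ⊗ s) ⊕ (u ⊗ s))
    sc-+     : ∀ a b → Eq Rel (sc (a + b)) (sc a ⊕ sc b)
    sc-*     : ∀ a b → Eq Rel (sc (a * b)) (sc a ⊗ sc b)
    sc-central : ∀ a t → Eq Rel (sc a ⊗ t) (t ⊗ sc a)

  record IsHom {X Y : Set} (RX : Term X → Term X → Set) (RY : Term Y → Term Y → Set)
               (f : Term X → Term Y) : Set (c ⊔ ℓ) where
    field
      well-defined : ∀ {s t} → Eq RX s t → Eq RY (f s) (f t)
      ⊕-hom : ∀ s t → Eq RY (f (s ⊕ t)) (f s ⊕ f t)
      ⊗-hom : ∀ s t → Eq RY (f (s ⊗ t)) (f s ⊗ f t)
      sc-hom : ∀ a → Eq RY (f (sc a)) (sc a)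

module QHahn {c ℓ} (F : Field c ℓ) (q : Field.Carrier F) where
  open Field F
  open FreeAlgebra commutativeRing public

  q⁻ : Carrier
  q⁻ = q ⁻¹

  ⟦_,_⟧q : {X : Set} → Term X → Term X → Term X
  ⟦ x , y ⟧q = sc q ⊗ x ⊗ y ⊖ sc q⁻ ⊗ y ⊗ x

  data HGen : Set where
    A B C : HGen

  𝐀 𝐁 𝐂 : Term HGen
  𝐀 = gen A
  𝐁 = gen B
  𝐂 = gen C

  P₁ P₂ P₃ : Term HGen
  P₁ = sc ((q * q - q⁻ * q⁻) ⁻¹) ⊗ ⟦ 𝐁 , 𝐂 ⟧q ⊕ 𝐀
  P₂ = ⟦ 𝐂 , 𝐀 ⟧q
  P₃ = sc ((q * q - q⁻ * q⁻) ⁻¹) ⊗ ⟦ 𝐀 , 𝐁 ⟧q ⊕ 𝐂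

  data HRel : Term HGen → Term HGen → Set where
    P₁-central : ∀ x → HRel ⟦ P₁ , gen x ⟧ (sc 0#)
    P₂-central : ∀ x → HRel ⟦ P₂ , gen x ⟧ (sc 0#)
    P₃-central : ∀ x → HRel ⟦ P₃ , gen x ⟧ (sc 0#)

  _≈H_ : Term HGen → Term HGen → Set (c ⊔ ℓ)
  _≈H_ = Eq HRel

  α β γ : Term HGen
  α = sc ((q - q⁻) ⁻¹) ⊗ ⟦ 𝐁 , 𝐂 ⟧q ⊕ sc (q + q⁻) ⊗ 𝐀
  β = sc ((q - q⁻) ⁻¹) ⊗ ⟦ 𝐂 , 𝐀 ⟧q
  γ = sc ((q - q⁻) ⁻¹) ⊗ ⟦ 𝐀 , 𝐁 ⟧q ⊕ sc (q + q⁻) ⊗ 𝐂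

  data WGen : Set where
    E₁ E₂ F₁ F₂ K₁ K₁⁻ K₂ K₂⁻ I I⁻ : WGen

  g : WGen → Term WGen
  g = gen

  data WRel : Term WGen → Term WGen → Set where
    I-central : ∀ x → WRel ⟦ g I , g x ⟧ (sc 0#)
    I-invʳ  : WRel (g I ⊗ g I⁻) (sc 1#)
    I-invˡ  : WRel (g I⁻ ⊗ g I) (sc 1#)
    K₁-invʳ : WRel (g K₁ ⊗ g K₁⁻) (sc 1#)
    K₁-invˡ : WRel (g K₁⁻ ⊗ g K₁) (sc 1#)
    K₂-invʳ : WRel (g K₂ ⊗ g K₂⁻) (sc 1#)
    K₂-invˡ : WRel (g K₂⁻ ⊗ g K₂) (sc 1#)
    K₁E₂ : WRel ⟦ g K₁ , g E₂ ⟧ (sc 0#)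
    K₁F₂ : WRel ⟦ g K₁ , g F₂ ⟧ (sc 0#)
    K₁K₂ : WRel ⟦ g K₁ , g K₂ ⟧ (sc 0#)
    K₂E₁ : WRel ⟦ g K₂ , g E₁ ⟧ (sc 0#)
    K₂F₁ : WRel ⟦ g K₂ , g F₁ ⟧ (sc 0#)
    E₁K₁q : WRel ⟦ g E₁ , g K₁ ⟧q (sc 0#)
    K₁F₁q : WRel ⟦ g K₁ , g F₁ ⟧q (sc 0#)
    E₂K₂q : WRel ⟦ g E₂ , g K₂ ⟧q (sc 0#)
    K₂F₂q : WRel ⟦ g K₂ , g F₂ ⟧q (sc 0#)
    E₁E₂ : WRel ⟦ g E₁ , g E₂ ⟧ (sc 0#)
    E₁F₂ : WRel ⟦ g E₁ , g F₂ ⟧ (sc 0#)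
    F₁E₂ : WRel ⟦ g F₁ , g E₂ ⟧ (sc 0#)
    F₁F₂ : WRel ⟦ g F₁ , g F₂ ⟧ (sc 0#)
    E₁F₁ : WRel ⟦ g E₁ , g F₁ ⟧ (sc ((q - q⁻) ⁻¹) ⊗ (g K₁ ⊖ g I ⊗ g K₁⁻))
    E₂F₂ : WRel ⟦ g E₂ , g F₂ ⟧ (sc ((q - q⁻) ⁻¹) ⊗ (g I ⊗ g K₂ ⊖ g K₂⁻))

  _≈W_ : Term WGen → Term WGen → Set (c ⊔ ℓ)
  _≈W_ = Eq WRel

  d² : Carrier
  d² = (q - q⁻) * (q - q⁻)

  Λ₁ Λ₂ Λ̃ : Term WGen
  Λ₁ = sc d² ⊗ g E₁ ⊗ g F₁ ⊕ sc q⁻ ⊗ g K₁ ⊕ sc q ⊗ g I ⊗ g K₁⁻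
  Λ₂ = sc d² ⊗ g E₂ ⊗ g F₂ ⊕ sc q⁻ ⊗ g I ⊗ g K₂ ⊕ sc q ⊗ g K₂⁻
  Λ̃ = sc d² ⊗ (g E₁ ⊕ g K₁⁻ ⊗ g E₂) ⊗ (g F₁ ⊗ g K₂ ⊕ g F₂)
       ⊕ sc q⁻ ⊗ g K₁ ⊗ g K₂ ⊕ sc q ⊗ g K₁⁻ ⊗ g K₂⁻

  imgA imgB imgC : Term WGen
  imgA = g K₂⁻
  imgB = Λ̃
  imgC = g I ⊗ g K₁⁻ ⊖ sc (q * d²) ⊗ g E₁ ⊗ g F₂ ⊗ g K₂⁻

  imgα imgβ imgγ : Term WGen
  imgα = Λ₂ ⊕ Λ₁ ⊗ g K₁⁻ ⊗ g K₂⁻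
  imgβ = g I ⊗ g K₁⁻ ⊗ g K₂⁻
  imgγ = Λ₁ ⊕ Λ₂ ⊗ g K₁⁻ ⊗ g K₂⁻

  IsHomHW : (Term HGen → Term WGen) → Set (c ⊔ ℓ)
  IsHomHW = IsHom HRel WRel

{-# OPTIONS --safe #-}
-- With eᵢ = (q − q⁻¹)² Eᵢ every relation of 𝔚_q becomes a rewriting rule with
-- coefficients in ℤ[q, q⁻¹] that sorts a word into a PBW monomial.  Comparing
-- normal forms yields [B,C]_q + (q² − q⁻²)A = (q − q⁻¹)(Λ₂ + Λ₁K₁⁻¹K₂⁻¹) and its
-- two analogues for the images of A, B, C, and shows that the images of α, β, γ
-- commute with those of A, B, C.  The central elements defining ℋ_q are scalar
-- multiples of α, β, γ, so the relations of ℋ_q hold in 𝔚_q.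
module Submission where

open import Defs
open import Level using (_⊔_)
open import Algebra.Bundles using (Ring; CommutativeRing)
import Algebra.Properties.Ring as RingProperties
import Algebra.Properties.AbelianGroup as AbelianGroupProperties
import Algebra.Properties.CommutativeSemigroup as CommutativeSemigroupProperties
import Algebra.Properties.Group as GroupProperties
open import Data.List using (List; []; _∷_; _++_; map)
import Data.List.Properties as List
open import Data.Maybe as Maybe using (Maybe; just; nothing)
open import Data.Nat using (ℕ; zero; suc)
import Data.Nat.Properties as ℕ
open import Data.Product using (Σ; _×_; _,_; proj₁; proj₂)
import Data.Product.Properties as Product
open import Data.Sign as Sign using (Sign)
import Data.Sign.Properties as Sign
open import Function using (_∘_)
open import Relation.Binary using (DecidableEquality)
open import Relation.Binary.PropositionalEquality as ≡ using (_≡_)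
import Relation.Binary.Reasoning.Setoid as SetoidReasoning
open import Relation.Nullary using (¬_; yes; no)
open import Relation.Nullary.Decidable using (map′)

-- Noncommutative polynomials over an alphabet, evaluated in a ring.

module Rewriting {c ℓ} (R : Ring c ℓ) {L : Set} (_≟_ : DecidableEquality L)
                 (ρ : L → Ring.Carrier R) where
  open Ring R
  open RingProperties R using (-‿involutive; -‿distribˡ-*; -‿distribʳ-*; -0#≈0#)
  open GroupProperties +-group using (x∙y⁻¹≈ε⇒x≈y)
  open AbelianGroupProperties +-abelianGroup using (⁻¹-∙-comm)
  open SetoidReasoning setoid

  Word = List L
  Monomial = Sign × Word
  -- Integer coefficients are stored by repeating signed words, so the calculus only ever decides
  -- equality of letters and signs and computes even over an abstract ring.
  Poly = List Monomial

  ⟦_⟧ʷ : Word → Carrier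
  ⟦ [] ⟧ʷ    = 1#
  ⟦ x ∷ w ⟧ʷ = ρ x * ⟦ w ⟧ʷ

  signed : Sign → Carrier → Carrier
  signed Sign.+ a = a
  signed Sign.- a = - a

  ⟦_⟧ᵐ : Monomial → Carrier
  ⟦ s , w ⟧ᵐ = signed s ⟦ w ⟧ʷ

  ⟦_⟧ᵖ : Poly → Carrier
  ⟦ [] ⟧ᵖ    = 0#
  ⟦ m ∷ p ⟧ᵖ = ⟦ m ⟧ᵐ + ⟦ p ⟧ᵖ

  -- Packing a polynomial with its correctness proof lets every transformation carry its own
  -- certificate, while computation looks at the first component alone.
  Reduct : Carrier → Set ℓ
  Reduct a = Σ Poly λ p → a ≈ ⟦ p ⟧ᵖ

  -- A rule sees two adjacent letters only, and `nothing` marks a pair already in order. Soundness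
  -- is built into each rule; whether the rules terminate or are confluent only affects which normal
  -- form comes out.
  Rules : Set ℓ
  Rules = ∀ x y → Maybe (Reduct (ρ x * ρ y))

  signed-cong : ∀ s {a b} → a ≈ b → signed s a ≈ signed s b
  signed-cong Sign.+ eq = eq
  signed-cong Sign.- eq = -‿cong eq

  signed-* : ∀ s t a b → signed (s Sign.* t) (a * b) ≈ signed s a * signed t b
  signed-* Sign.+ Sign.+ a b = refl
  signed-* Sign.+ Sign.- a b = -‿distribʳ-* a b
  signed-* Sign.- Sign.+ a b = -‿distribˡ-* a b
  signed-* Sign.- Sign.- a b = begin
    a * b          ≈⟨ -‿involutive (a * b) ⟨
    - - (a * b)    ≈⟨ -‿cong (-‿distribˡ-* a b) ⟩
    - (- a * b)    ≈⟨ -‿distribʳ-* (- a) b ⟩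
    - a * - b      ∎

  signed-signed : ∀ s t a → signed (s Sign.* t) a ≈ signed s (signed t a)
  signed-signed Sign.+ t      a = refl
  signed-signed Sign.- Sign.+ a = refl
  signed-signed Sign.- Sign.- a = sym (-‿involutive a)

  signed-0# : ∀ s → signed s 0# ≈ 0#
  signed-0# Sign.+ = refl
  signed-0# Sign.- = -0#≈0#

  signed-+ : ∀ s a b → signed s (a + b) ≈ signed s a + signed s b
  signed-+ Sign.+ a b = refl
  signed-+ Sign.- a b = sym (⁻¹-∙-comm a b)

  signed-opposite : ∀ s a → signed s a + signed (Sign.opposite s) a ≈ 0#
  signed-opposite Sign.+ a = -‿inverseʳ a
  signed-opposite Sign.- a = -‿inverseˡ a

  ++-homo : ∀ u w → ⟦ u ++ w ⟧ʷ ≈ ⟦ u ⟧ʷ * ⟦ w ⟧ʷ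
  ++-homo []      w = sym (*-identityˡ _)
  ++-homo (x ∷ u) w = trans (*-congˡ (++-homo u w)) (sym (*-assoc _ _ _))

  _·ᵐ_ : Monomial → Poly → Poly
  (s , u) ·ᵐ p = map (λ { (t , w) → s Sign.* t , u ++ w }) p

  ·ᵐ-homo : ∀ m p → ⟦ m ·ᵐ p ⟧ᵖ ≈ ⟦ m ⟧ᵐ * ⟦ p ⟧ᵖ
  ·ᵐ-homo m       []            = sym (zeroʳ _)
  ·ᵐ-homo (s , u) ((t , w) ∷ p) = begin
    signed (s Sign.* t) ⟦ u ++ w ⟧ʷ + ⟦ (s , u) ·ᵐ p ⟧ᵖ
      ≈⟨ +-cong (trans (signed-cong (s Sign.* t) (++-homo u w)) (signed-* s t _ _)) (·ᵐ-homo (s , u) p) ⟩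
    ⟦ s , u ⟧ᵐ * ⟦ t , w ⟧ᵐ + ⟦ s , u ⟧ᵐ * ⟦ p ⟧ᵖ
      ≈⟨ distribˡ _ _ _ ⟨
    ⟦ s , u ⟧ᵐ * (⟦ t , w ⟧ᵐ + ⟦ p ⟧ᵖ) ∎

  signᵖ : Sign → Poly → Poly
  signᵖ s = map (λ { (t , w) → s Sign.* t , w })

  signᵖ-homo : ∀ s p → ⟦ signᵖ s p ⟧ᵖ ≈ signed s ⟦ p ⟧ᵖ
  signᵖ-homo s []            = sym (signed-0# s)
  signᵖ-homo s ((t , w) ∷ p) =
    trans (+-cong (signed-signed s t _) (signᵖ-homo s p)) (sym (signed-+ s _ _))

  _≟ᵐ_ : DecidableEquality Monomial
  _≟ᵐ_ = Product.≡-dec Sign._≟_ (List.≡-dec _≟_)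

  -- All cancellation takes place here. A list built from `[]` by insertions never holds a monomial
  -- together with its opposite, so a sum that vanishes formally ends up as `[]`.
  insert : Monomial → Poly → Poly
  insert m       []      = m ∷ []
  insert (s , w) (n ∷ p) with n ≟ᵐ (Sign.opposite s , w)
  ... | yes _ = p
  ... | no  _ = n ∷ insert (s , w) p

  insert-homo : ∀ m p → ⟦ insert m p ⟧ᵖ ≈ ⟦ m ⟧ᵐ + ⟦ p ⟧ᵖ
  insert-homo m       []      = refl
  insert-homo (s , w) (n ∷ p) with n ≟ᵐ (Sign.opposite s , w)
  ... | yes ≡.refl = begin
    ⟦ p ⟧ᵖ                              ≈⟨ +-identityˡ _ ⟨
    0# + ⟦ p ⟧ᵖ                         ≈⟨ +-congʳ (signed-opposite s _) ⟨
    ⟦ s , w ⟧ᵐ + ⟦ n ⟧ᵐ + ⟦ p ⟧ᵖ        ≈⟨ +-assoc _ _ _ ⟩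
    ⟦ s , w ⟧ᵐ + (⟦ n ⟧ᵐ + ⟦ p ⟧ᵖ)      ∎
  ... | no _ = begin
    ⟦ n ⟧ᵐ + ⟦ insert (s , w) p ⟧ᵖ      ≈⟨ +-congˡ (insert-homo (s , w) p) ⟩
    ⟦ n ⟧ᵐ + (⟦ s , w ⟧ᵐ + ⟦ p ⟧ᵖ)      ≈⟨ +-assoc _ _ _ ⟨
    ⟦ n ⟧ᵐ + ⟦ s , w ⟧ᵐ + ⟦ p ⟧ᵖ        ≈⟨ +-congʳ (+-comm _ _) ⟩
    ⟦ s , w ⟧ᵐ + ⟦ n ⟧ᵐ + ⟦ p ⟧ᵖ        ≈⟨ +-assoc _ _ _ ⟩
    ⟦ s , w ⟧ᵐ + (⟦ n ⟧ᵐ + ⟦ p ⟧ᵖ)      ∎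

  infixl 6 _+ᵖ_
  infixl 7 _*ᵖ_

  _+ᵖ_ : Poly → Poly → Poly
  []      +ᵖ r = r
  (m ∷ p) +ᵖ r = insert m (p +ᵖ r)

  +ᵖ-homo : ∀ p r → ⟦ p +ᵖ r ⟧ᵖ ≈ ⟦ p ⟧ᵖ + ⟦ r ⟧ᵖ
  +ᵖ-homo []      r = sym (+-identityˡ _)
  +ᵖ-homo (m ∷ p) r = begin
    ⟦ insert m (p +ᵖ r) ⟧ᵖ          ≈⟨ insert-homo m (p +ᵖ r) ⟩
    ⟦ m ⟧ᵐ + ⟦ p +ᵖ r ⟧ᵖ            ≈⟨ +-congˡ (+ᵖ-homo p r) ⟩
    ⟦ m ⟧ᵐ + (⟦ p ⟧ᵖ + ⟦ r ⟧ᵖ)      ≈⟨ +-assoc _ _ _ ⟨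
    ⟦ m ∷ p ⟧ᵖ + ⟦ r ⟧ᵖ             ∎

  _*ᵖ_ : Poly → Poly → Poly
  []      *ᵖ r = []
  (m ∷ p) *ᵖ r = (m ·ᵐ r) +ᵖ (p *ᵖ r)

  *ᵖ-homo : ∀ p r → ⟦ p *ᵖ r ⟧ᵖ ≈ ⟦ p ⟧ᵖ * ⟦ r ⟧ᵖ
  *ᵖ-homo []      r = sym (zeroˡ _)
  *ᵖ-homo (m ∷ p) r = begin
    ⟦ (m ·ᵐ r) +ᵖ (p *ᵖ r) ⟧ᵖ              ≈⟨ +ᵖ-homo (m ·ᵐ r) (p *ᵖ r) ⟩
    ⟦ m ·ᵐ r ⟧ᵖ + ⟦ p *ᵖ r ⟧ᵖ              ≈⟨ +-cong (·ᵐ-homo m r) (*ᵖ-homo p r) ⟩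
    ⟦ m ⟧ᵐ * ⟦ r ⟧ᵖ + ⟦ p ⟧ᵖ * ⟦ r ⟧ᵖ      ≈⟨ distribʳ _ _ _ ⟨
    ⟦ m ∷ p ⟧ᵖ * ⟦ r ⟧ᵖ                    ∎

  word : Word → Poly
  word w = (Sign.+ , w) ∷ []

  word-correct : ∀ w → ⟦ w ⟧ʷ ≈ ⟦ word w ⟧ᵖ
  word-correct w = sym (+-identityʳ _)

  -- Normalisation of ring expressions and proof by reflection.

  infixl 6 _:+_ _:-_
  infixl 7 _:*_

  data Expr : Set where
    var       : L → Expr
    _:+_ _:*_ : Expr → Expr → Expr
    :-_       : Expr → Expr

  _:-_ : Expr → Expr → Expr
  a :- b = a :+ (:- b)

  ⟦_⟧ : Expr → Carrier
  ⟦ var x ⟧  = ρ x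
  ⟦ a :+ b ⟧ = ⟦ a ⟧ + ⟦ b ⟧
  ⟦ a :* b ⟧ = ⟦ a ⟧ * ⟦ b ⟧
  ⟦ :- a ⟧   = - ⟦ a ⟧

  expand : ∀ a → Reduct ⟦ a ⟧
  expand (var x)  = word (x ∷ []) , trans (sym (*-identityʳ _)) (word-correct (x ∷ []))
  expand (a :+ b) = let p , p-eq = expand a ; r , r-eq = expand b in
    p +ᵖ r , trans (+-cong p-eq r-eq) (sym (+ᵖ-homo p r))
  expand (a :* b) = let p , p-eq = expand a ; r , r-eq = expand b in
    p *ᵖ r , trans (*-cong p-eq r-eq) (sym (*ᵖ-homo p r))
  expand (:- a)   = let p , p-eq = expand a in
    signᵖ Sign.- p , trans (-‿cong p-eq) (sym (signᵖ-homo Sign.- p))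

  module _ (rules : Rules) where

    step : ∀ w → Maybe (Reduct ⟦ w ⟧ʷ)
    step []          = nothing
    step (x ∷ [])    = nothing
    -- The head pair takes precedence over the tail, so the leftmost reducible pair is rewritten.
    step (x ∷ y ∷ w) = Maybe.map append (rules x y) Maybe.<∣> Maybe.map prepend (step (y ∷ w))
      where
      append : Reduct (ρ x * ρ y) → Reduct ⟦ x ∷ y ∷ w ⟧ʷ
      append (p , eq) = p *ᵖ word w , (begin
        ρ x * (ρ y * ⟦ w ⟧ʷ)        ≈⟨ *-assoc _ _ _ ⟨
        ρ x * ρ y * ⟦ w ⟧ʷ          ≈⟨ *-cong eq (word-correct w) ⟩
        ⟦ p ⟧ᵖ * ⟦ word w ⟧ᵖ        ≈⟨ *ᵖ-homo p (word w) ⟨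
        ⟦ p *ᵖ word w ⟧ᵖ            ∎)

      prepend : Reduct ⟦ y ∷ w ⟧ʷ → Reduct ⟦ x ∷ y ∷ w ⟧ʷ
      prepend (p , eq) = (Sign.+ , x ∷ []) ·ᵐ p , (begin
        ρ x * ⟦ y ∷ w ⟧ʷ                  ≈⟨ *-cong (sym (*-identityʳ _)) eq ⟩
        ρ x * 1# * ⟦ p ⟧ᵖ                 ≈⟨ ·ᵐ-homo (Sign.+ , x ∷ []) p ⟨
        ⟦ (Sign.+ , x ∷ []) ·ᵐ p ⟧ᵖ       ∎)

    -- The first argument bounds the number of successive rewriting steps.
    normaliseʷ : ℕ → ∀ w → Reduct ⟦ w ⟧ʷ
    normaliseᵖ : ℕ → ∀ p → Reduct ⟦ p ⟧ᵖ

    normaliseʷ zero    w = word w , word-correct w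
    normaliseʷ (suc n) w with step w
    ... | nothing       = word w , word-correct w
    ... | just (p , eq) = let r , r-eq = normaliseᵖ n p in r , trans eq r-eq

    normaliseᵖ n []            = [] , refl
    normaliseᵖ n ((s , w) ∷ p) =
      let v , v-eq = normaliseʷ n w ; r , r-eq = normaliseᵖ n p in
      signᵖ s v +ᵖ r , (begin
        signed s ⟦ w ⟧ʷ + ⟦ p ⟧ᵖ        ≈⟨ +-cong (signed-cong s v-eq) r-eq ⟩
        signed s ⟦ v ⟧ᵖ + ⟦ r ⟧ᵖ        ≈⟨ +-congʳ (signᵖ-homo s v) ⟨
        ⟦ signᵖ s v ⟧ᵖ + ⟦ r ⟧ᵖ         ≈⟨ +ᵖ-homo (signᵖ s v) r ⟨
        ⟦ signᵖ s v +ᵖ r ⟧ᵖ             ∎)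

    normalise : ∀ a → Reduct ⟦ a ⟧
    normalise a =
      -- The bound 200 limits the depth of rewriting from each word. Any bound gives a correct
      -- reduct; it must be large enough for the differences tested below to reach `[]`.
      let p , p-eq = expand a ; r , r-eq = normaliseᵖ 200 p in r , trans p-eq r-eq

    -- Proof by reflection: on concrete expressions the type checker evaluates the normal form of
    -- the difference, and `≡.refl` discharges the hypothesis.
    prove : ∀ a b → proj₁ (normalise (a :- b)) ≡ [] → ⟦ a ⟧ ≈ ⟦ b ⟧
    prove a b eq = x∙y⁻¹≈ε⇒x≈y _ _
      (≡.subst (λ p → ⟦ a :- b ⟧ ≈ ⟦ p ⟧ᵖ) eq (proj₂ (normalise (a :- b))))

-- Presented algebras as rings, and commutation up to a scalar.

module Presented {c ℓ} (R : CommutativeRing c ℓ) {X : Set}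
                 (Rel : FreeAlgebra.Term R X → FreeAlgebra.Term R X → Set) where
  private module R = CommutativeRing R
  open FreeAlgebra R

  presentedRing : Ring c (c ⊔ ℓ)
  presentedRing = record
    { Carrier = Term X ; _≈_ = Eq Rel ; _+_ = _⊕_ ; _*_ = _⊗_
    ; -_ = ⊖_ ; 0# = sc R.0# ; 1# = sc R.1#
    ; isRing = record
      { +-isAbelianGroup = record
        { isGroup = record
          { isMonoid = record
            { isSemigroup = record
              { isMagma = record
                { isEquivalence = record { refl = refl′ ; sym = sym′ ; trans = trans′ }
                ; ∙-cong = ⊕-cong }
              ; assoc = ⊕-assoc }
            ; identity = ⊕-idˡ , λ t → trans′ (⊕-comm t _) (⊕-idˡ t) }
          ; inverse = (λ t → trans′ (⊕-comm _ t) (⊕-inv t)) , ⊕-inv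
          ; ⁻¹-cong = ⊗-cong refl′ }
        ; comm = ⊕-comm }
      ; *-cong = ⊗-cong
      ; *-assoc = ⊗-assoc
      ; *-identity = ⊗-idˡ , ⊗-idʳ
      ; distrib = distribˡ , distribʳ } }

  open Ring presentedRing using
    (_≈_; setoid; +-group; +-congˡ; *-congˡ; *-congʳ; *-identityˡ; *-identityʳ; sym; trans)
  open GroupProperties +-group using (x∙y⁻¹≈ε⇒x≈y; x≈y⇒x∙y⁻¹≈ε)
  open SetoidReasoning setoid

  sc-sub : ∀ a b → sc (a R.- b) ≈ sc a ⊖ sc b
  sc-sub a b = begin
    sc (a R.- b)                    ≈⟨ sc-+ a (R.- b) ⟩
    sc a ⊕ sc (R.- b)               ≈⟨ +-congˡ (sc-cong (RingProperties.-1*x≈-x R.ring b)) ⟨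
    sc a ⊕ sc (R.- R.1# R.* b)      ≈⟨ +-congˡ (sc-* _ b) ⟩
    sc a ⊖ sc b                     ∎

  sc-assoc : ∀ {a b s} → a R.* b R.≈ s → ∀ t → sc a ⊗ (sc b ⊗ t) ≈ sc s ⊗ t
  sc-assoc {a} {b} {s} ab≈s t = begin
    sc a ⊗ (sc b ⊗ t)       ≈⟨ ⊗-assoc _ _ _ ⟨
    sc a ⊗ sc b ⊗ t         ≈⟨ *-congʳ (sc-* a b) ⟨
    sc (a R.* b) ⊗ t        ≈⟨ *-congʳ (sc-cong ab≈s) ⟩
    sc s ⊗ t                ∎

  sc-cancel : ∀ {a b} → a R.* b R.≈ R.1# → ∀ t → sc a ⊗ (sc b ⊗ t) ≈ t
  sc-cancel ab≈1 t = trans (sc-assoc ab≈1 t) (*-identityˡ t)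

  sc-factor : ∀ {a b s} → a R.* b R.≈ s → ∀ t u →
              sc a ⊗ t ⊕ sc s ⊗ u ≈ sc a ⊗ (t ⊕ sc b ⊗ u)
  sc-factor ab≈s t u = trans (+-congˡ (sym (sc-assoc ab≈s u))) (sym (distribˡ _ _ _))

  sc-pull : ∀ a t u → t ⊗ (sc a ⊗ u) ≈ sc a ⊗ (t ⊗ u)
  sc-pull a t u = begin
    t ⊗ (sc a ⊗ u)     ≈⟨ ⊗-assoc _ _ _ ⟨
    t ⊗ sc a ⊗ u       ≈⟨ *-congʳ (sc-central a t) ⟨
    sc a ⊗ t ⊗ u       ≈⟨ ⊗-assoc _ _ _ ⟩
    sc a ⊗ (t ⊗ u)     ∎

  commutator⇒commute : ∀ {t u} → ⟦ t , u ⟧ ≈ sc R.0# → t ⊗ u ≈ u ⊗ t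
  commutator⇒commute = x∙y⁻¹≈ε⇒x≈y _ _

  commute⇒commutator : ∀ {t u} → t ⊗ u ≈ u ⊗ t → ⟦ t , u ⟧ ≈ sc R.0#
  commute⇒commutator = x≈y⇒x∙y⁻¹≈ε

  -- Transfers commutation from the images of α, β, γ to those of `P₁`, `P₂`, `P₃`, which are scalar
  -- multiples of them.
  scaled-commutator : ∀ {p z} a → p ≈ sc a ⊗ z → ∀ {t} → z ⊗ t ≈ t ⊗ z → ⟦ p , t ⟧ ≈ sc R.0#
  scaled-commutator {p} {z} a p≈az {t} zt≈tz = commute⇒commutator (begin
    p ⊗ t              ≈⟨ *-congʳ p≈az ⟩
    sc a ⊗ z ⊗ t       ≈⟨ ⊗-assoc _ _ _ ⟩
    sc a ⊗ (z ⊗ t)     ≈⟨ *-congˡ zt≈tz ⟩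
    sc a ⊗ (t ⊗ z)     ≈⟨ sc-pull a t z ⟨
    t ⊗ (sc a ⊗ z)     ≈⟨ *-congˡ p≈az ⟨
    t ⊗ p              ∎)

  -- Common form of the relations of 𝔚_q other than the inverse relations and the two for [Eᵢ,Fᵢ];
  -- the scalars that occur are 1, q² and q⁻².
  CommuteUpTo : R.Carrier → Term X → Term X → Set (c ⊔ ℓ)
  CommuteUpTo a t u = t ⊗ u ≈ sc a ⊗ (u ⊗ t)

  commute⇒upTo1 : ∀ {t u} → t ⊗ u ≈ u ⊗ t → CommuteUpTo R.1# t u
  commute⇒upTo1 eq = trans eq (sym (*-identityˡ _))

  flip-upTo : ∀ {a b t u} → b R.* a R.≈ R.1# → CommuteUpTo a t u → CommuteUpTo b u t
  flip-upTo ba≈1 eq = trans (sym (sc-cancel ba≈1 _)) (*-congˡ (sym eq))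

  scale-upTo : ∀ {a t u} b → CommuteUpTo a t u → CommuteUpTo a (sc b ⊗ t) u
  scale-upTo {a} {t} {u} b eq = begin
    sc b ⊗ t ⊗ u                  ≈⟨ ⊗-assoc _ _ _ ⟩
    sc b ⊗ (t ⊗ u)                ≈⟨ *-congˡ eq ⟩
    sc b ⊗ (sc a ⊗ (u ⊗ t))       ≈⟨ sc-pull a (sc b) (u ⊗ t) ⟩
    sc a ⊗ (sc b ⊗ (u ⊗ t))       ≈⟨ *-congˡ (sc-pull b u t) ⟨
    sc a ⊗ (u ⊗ (sc b ⊗ t))       ∎

  -- Multiplying tu = a ut by u⁻¹ on both sides gives u⁻¹t = a tu⁻¹. This supplies the relations for
  -- Kᵢ⁻¹, which the presentation leaves implicit.
  invert-upTo : ∀ {a b t u u⁻} → b R.* a R.≈ R.1# → u ⊗ u⁻ ≈ sc R.1# → u⁻ ⊗ u ≈ sc R.1# →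
                CommuteUpTo a t u → CommuteUpTo b t u⁻
  invert-upTo {a} {b} {t} {u} {u⁻} ba≈1 uu⁻≈1 u⁻u≈1 eq = sym (begin
    sc b ⊗ (u⁻ ⊗ t)                        ≈⟨ *-congˡ (*-identityʳ _) ⟨
    sc b ⊗ (u⁻ ⊗ t ⊗ sc R.1#)              ≈⟨ *-congˡ (*-congˡ uu⁻≈1) ⟨
    sc b ⊗ (u⁻ ⊗ t ⊗ (u ⊗ u⁻))             ≈⟨ *-congˡ (trans (sym (⊗-assoc _ _ _)) (*-congʳ (⊗-assoc _ _ _))) ⟩
    sc b ⊗ (u⁻ ⊗ (t ⊗ u) ⊗ u⁻)             ≈⟨ *-congˡ (*-congʳ (*-congˡ eq)) ⟩
    sc b ⊗ (u⁻ ⊗ (sc a ⊗ (u ⊗ t)) ⊗ u⁻)    ≈⟨ *-congˡ (*-congʳ (sc-pull a u⁻ (u ⊗ t))) ⟩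
    sc b ⊗ (sc a ⊗ (u⁻ ⊗ (u ⊗ t)) ⊗ u⁻)    ≈⟨ *-congˡ (⊗-assoc _ _ _) ⟩
    sc b ⊗ (sc a ⊗ (u⁻ ⊗ (u ⊗ t) ⊗ u⁻))    ≈⟨ sc-cancel ba≈1 _ ⟩
    u⁻ ⊗ (u ⊗ t) ⊗ u⁻                      ≈⟨ *-congʳ (⊗-assoc _ _ _) ⟨
    u⁻ ⊗ u ⊗ t ⊗ u⁻                        ≈⟨ *-congʳ (trans (*-congʳ u⁻u≈1) (*-identityˡ t)) ⟩
    t ⊗ u⁻                                 ∎)

-- Universal property of a presented algebra.

module _ {c ℓ} (R : CommutativeRing c ℓ) {X Y : Set} where
  open FreeAlgebra R

  extend : (X → Term Y) → Term X → Term Y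
  extend φ (gen x) = φ x
  extend φ (sc a)  = sc a
  extend φ (s ⊕ t) = extend φ s ⊕ extend φ t
  extend φ (s ⊗ t) = extend φ s ⊗ extend φ t

  module _ {RX : Term X → Term X → Set} {RY : Term Y → Term Y → Set} (φ : X → Term Y) where

    -- `extend` commutes with the term constructors definitionally, so each algebra axiom goes to an
    -- instance of itself and only the relations of the source need an argument.
    extend-cong : (∀ {s t} → RX s t → Eq RY (extend φ s) (extend φ t)) →
                  ∀ {s t} → Eq RX s t → Eq RY (extend φ s) (extend φ t)
    extend-cong r (rel x)          = r x
    extend-cong r refl′            = refl′
    extend-cong r (sym′ p)         = sym′ (extend-cong r p)
    extend-cong r (trans′ p p′)    = trans′ (extend-cong r p) (extend-cong r p′)
    extend-cong r (⊕-cong p p′)    = ⊕-cong (extend-cong r p) (extend-cong r p′)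
    extend-cong r (⊗-cong p p′)    = ⊗-cong (extend-cong r p) (extend-cong r p′)
    extend-cong r (sc-cong x)      = sc-cong x
    extend-cong r (⊕-assoc s t u)  = ⊕-assoc _ _ _
    extend-cong r (⊕-comm s t)     = ⊕-comm _ _
    extend-cong r (⊕-idˡ t)        = ⊕-idˡ _
    extend-cong r (⊕-inv t)        = ⊕-inv _
    extend-cong r (⊗-assoc s t u)  = ⊗-assoc _ _ _
    extend-cong r (⊗-idˡ t)        = ⊗-idˡ _
    extend-cong r (⊗-idʳ t)        = ⊗-idʳ _
    extend-cong r (distribˡ s t u) = distribˡ _ _ _
    extend-cong r (distribʳ s t u) = distribʳ _ _ _
    extend-cong r (sc-+ a b)       = sc-+ a b
    extend-cong r (sc-* a b)       = sc-* a b
    extend-cong r (sc-central a t) = sc-central a _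

    extend-isHom : (∀ {s t} → RX s t → Eq RY (extend φ s) (extend φ t)) → IsHom RX RY (extend φ)
    extend-isHom r = record
      { well-defined = extend-cong r
      ; ⊕-hom  = λ _ _ → refl′
      ; ⊗-hom  = λ _ _ → refl′
      ; sc-hom = λ _ → refl′ }

    extend-unique : ∀ {h} → IsHom RX RY h → (∀ x → Eq RY (h (gen x)) (φ x)) →
                    ∀ t → Eq RY (h t) (extend φ t)
    extend-unique hom eq (gen x) = eq x
    extend-unique hom eq (sc a)  = IsHom.sc-hom hom a
    extend-unique hom eq (s ⊕ t) =
      trans′ (IsHom.⊕-hom hom s t) (⊕-cong (extend-unique hom eq s) (extend-unique hom eq t))
    extend-unique hom eq (s ⊗ t) =
      trans′ (IsHom.⊗-hom hom s t) (⊗-cong (extend-unique hom eq s) (extend-unique hom eq t))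

-- The PBW alphabet of 𝔚_q.

-- eᵢ stands for (q − q⁻¹)² Eᵢ; normal words list the letters in this order.
data Letter : Set where
  v v⁻ ι k₁ k₁⁻ k₂ k₂⁻ e₁ e₂ f₁ f₂ : Letter

-- Numbering the letters transfers decidable equality from ℕ and avoids a case split over all pairs
-- of letters.
code : Letter → ℕ
code v   = 0
code v⁻  = 1
code ι   = 2
code k₁  = 3
code k₁⁻ = 4
code k₂  = 5
code k₂⁻ = 6
code e₁  = 7
code e₂  = 8
code f₁  = 9
code f₂  = 10

decode : ℕ → Letter
decode 0 = v
decode 1 = v⁻
decode 2 = ι
decode 3 = k₁
decode 4 = k₁⁻
decode 5 = k₂
decode 6 = k₂⁻
decode 7 = e₁
decode 8 = e₂
decode 9 = f₁
decode _ = f₂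

decode-code : ∀ x → decode (code x) ≡ x
decode-code v   = ≡.refl
decode-code v⁻  = ≡.refl
decode-code ι   = ≡.refl
decode-code k₁  = ≡.refl
decode-code k₁⁻ = ≡.refl
decode-code k₂  = ≡.refl
decode-code k₂⁻ = ≡.refl
decode-code e₁  = ≡.refl
decode-code e₂  = ≡.refl
decode-code f₁  = ≡.refl
decode-code f₂  = ≡.refl

_≟ᴸ_ : DecidableEquality Letter
x ≟ᴸ y = map′ code-injective (≡.cong code) (code x ℕ.≟ code y)
  where
  code-injective : code x ≡ code y → x ≡ y
  code-injective eq = ≡.trans (≡.sym (decode-code x)) (≡.trans (≡.cong decode eq) (decode-code y))

-- Scalar identities and invertibility of q - q⁻¹ and q² - q⁻².

module FieldFacts {c ℓ} (F : Field c ℓ) (q : Field.Carrier F)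
                  (q≉0 : ¬ (Field._≈_ F q (Field.0# F))) (q-generic : NotRootOfUnity F q) where
  open Field F
  open QHahn F q using (q⁻; d²)
  open RingProperties ring using ([y-z]x≈yx-zx)
  open CommutativeSemigroupProperties *-commutativeSemigroup using (interchange)
  open GroupProperties +-group using (x∙y⁻¹≈ε⇒x≈y)
  open SetoidReasoning setoid

  d d₂ d⁻ d₂⁻ : Carrier
  d   = q - q⁻
  d₂  = q * q - q⁻ * q⁻
  d⁻  = d ⁻¹
  d₂⁻ = d₂ ⁻¹

  qq⁻≈1 : q * q⁻ ≈ 1#
  qq⁻≈1 = ⁻¹-inverse q q≉0

  q⁻q≈1 : q⁻ * q ≈ 1#
  q⁻q≈1 = trans (*-comm _ _) qq⁻≈1

  q²q⁻²≈1 : (q * q) * (q⁻ * q⁻) ≈ 1#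
  q²q⁻²≈1 = trans (interchange q q q⁻ q⁻) (trans (*-cong qq⁻≈1 qq⁻≈1) (*-identityˡ 1#))

  q⁻²q²≈1 : (q⁻ * q⁻) * (q * q) ≈ 1#
  q⁻²q²≈1 = trans (*-comm _ _) q²q⁻²≈1

  -- If q = q⁻¹ then q² = 1. `NotRootOfUnity` is indexed by the exponent minus one, hence the
  -- argument 1.
  d≉0 : ¬ (d ≈ 0#)
  d≉0 d≈0 = q-generic 1 (begin
    q * (q * 1#)    ≈⟨ *-congˡ (*-identityʳ q) ⟩
    q * q           ≈⟨ *-congˡ (x∙y⁻¹≈ε⇒x≈y _ _ d≈0) ⟩
    q * q⁻          ≈⟨ qq⁻≈1 ⟩
    1#              ∎)

  -- If q² = q⁻² then q⁴ = 1, which is index 3.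
  d₂≉0 : ¬ (d₂ ≈ 0#)
  d₂≉0 d₂≈0 = q-generic 3 (begin
    q * (q * (q * (q * 1#)))    ≈⟨ *-congˡ (*-congˡ (*-congˡ (*-identityʳ q))) ⟩
    q * (q * (q * q))           ≈⟨ *-assoc q q (q * q) ⟨
    (q * q) * (q * q)           ≈⟨ *-congˡ (x∙y⁻¹≈ε⇒x≈y _ _ d₂≈0) ⟩
    (q * q) * (q⁻ * q⁻)         ≈⟨ q²q⁻²≈1 ⟩
    1#                          ∎)

  d⁻d≈1 : d⁻ * d ≈ 1#
  d⁻d≈1 = trans (*-comm _ _) (⁻¹-inverse d d≉0)

  d₂⁻d₂≈1 : d₂⁻ * d₂ ≈ 1#
  d₂⁻d₂≈1 = trans (*-comm _ _) (⁻¹-inverse d₂ d₂≉0)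

  d²d⁻≈d : d² * d⁻ ≈ d
  d²d⁻≈d = trans (*-assoc d d d⁻) (trans (*-congˡ (⁻¹-inverse d d≉0)) (*-identityʳ d))

  difference-of-squares : ∀ a b → a * a - b * b ≈ (a - b) * (a + b)
  difference-of-squares a b = sym (begin
    (a - b) * (a + b)                              ≈⟨ distribˡ _ _ _ ⟩
    (a - b) * a + (a - b) * b                      ≈⟨ +-cong ([y-z]x≈yx-zx a a b) ([y-z]x≈yx-zx b a b) ⟩
    (a * a - b * a) + (a * b - b * b)              ≈⟨ +-assoc _ _ _ ⟩
    a * a + (- (b * a) + (a * b - b * b))          ≈⟨ +-congˡ (+-assoc _ _ _) ⟨
    a * a + (- (b * a) + a * b - b * b)            ≈⟨ +-congˡ (+-congʳ (+-congˡ (*-comm a b))) ⟩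
    a * a + (- (b * a) + b * a - b * b)            ≈⟨ +-congˡ (+-congʳ (-‿inverseˡ _)) ⟩
    a * a + (0# - b * b)                           ≈⟨ +-congˡ (+-identityˡ _) ⟩
    a * a - b * b                                  ∎)

  -- Explains the coefficient q + q⁻¹ in α and γ: it is what q² - q⁻² becomes after division by q -
  -- q⁻¹.
  d⁻d₂≈q+q⁻ : d⁻ * d₂ ≈ q + q⁻
  d⁻d₂≈q+q⁻ = begin
    d⁻ * d₂                ≈⟨ *-congˡ (difference-of-squares q q⁻) ⟩
    d⁻ * (d * (q + q⁻))    ≈⟨ *-assoc _ _ _ ⟨
    d⁻ * d * (q + q⁻)      ≈⟨ *-congʳ d⁻d≈1 ⟩
    1# * (q + q⁻)          ≈⟨ *-identityˡ _ ⟩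
    q + q⁻                 ∎

-- Commutation relations in 𝔚_q.

module HahnToW {c ℓ} (F : Field c ℓ) (q : Field.Carrier F)
               (q≉0 : ¬ (Field._≈_ F q (Field.0# F))) (q-generic : NotRootOfUnity F q) where
  open QHahn F q
  open FieldFacts F q q≉0 q-generic
  private module F = Field F
  open Presented F.commutativeRing WRel
  open Ring presentedRing using
    ( _≈_; setoid; +-congˡ; +-congʳ; *-congˡ; *-congʳ; +-cong; *-cong; -‿cong; *-identityˡ
    ; refl; sym; trans; +-group; +-identityʳ; -‿inverseʳ)
  open GroupProperties +-group using (x∙y⁻¹≈ε⇒x≈y)
  open SetoidReasoning setoid

  -- The scalars q and q⁻¹ enter as letters, so sorting words also carries out the coefficient
  -- arithmetic in ℤ[q, q⁻¹].
  ρ : Letter → Term WGen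
  ρ v   = sc q
  ρ v⁻  = sc q⁻
  ρ ι   = g I
  ρ k₁  = g K₁
  ρ k₁⁻ = g K₁⁻
  ρ k₂  = g K₂
  ρ k₂⁻ = g K₂⁻
  ρ e₁  = sc d² ⊗ g E₁
  ρ e₂  = sc d² ⊗ g E₂
  ρ f₁  = g F₁
  ρ f₂  = g F₂

  open Rewriting presentedRing _≟ᴸ_ ρ renaming (⟦_⟧ to ⟪_⟫)

  -- Multiply q tu = q⁻¹ ut by q⁻¹.
  q-commutator⇒upTo : ∀ {t u} → ⟦ t , u ⟧q ≈ sc F.0# → CommuteUpTo (q⁻ F.* q⁻) t u
  q-commutator⇒upTo {t} {u} eq = begin
    t ⊗ u                          ≈⟨ sc-cancel q⁻q≈1 _ ⟨
    sc q⁻ ⊗ (sc q ⊗ (t ⊗ u))       ≈⟨ *-congˡ (⊗-assoc _ _ _) ⟨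
    sc q⁻ ⊗ (sc q ⊗ t ⊗ u)         ≈⟨ *-congˡ (x∙y⁻¹≈ε⇒x≈y _ _ eq) ⟩
    sc q⁻ ⊗ (sc q⁻ ⊗ u ⊗ t)        ≈⟨ *-congˡ (⊗-assoc _ _ _) ⟩
    sc q⁻ ⊗ (sc q⁻ ⊗ (u ⊗ t))      ≈⟨ sc-assoc F.refl _ ⟩
    sc (q⁻ F.* q⁻) ⊗ (u ⊗ t)       ∎

  1*1≈1 : F.1# F.* F.1# F.≈ F.1#
  1*1≈1 = F.*-identityˡ F.1#

  E₁K₁~ : CommuteUpTo (q⁻ F.* q⁻) (g E₁) (g K₁)
  E₁K₁~ = q-commutator⇒upTo (rel E₁K₁q)

  E₂K₂~ : CommuteUpTo (q⁻ F.* q⁻) (g E₂) (g K₂)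
  E₂K₂~ = q-commutator⇒upTo (rel E₂K₂q)

  F₁K₁~ : CommuteUpTo (q F.* q) (g F₁) (g K₁)
  F₁K₁~ = flip-upTo q²q⁻²≈1 (q-commutator⇒upTo (rel K₁F₁q))

  F₂K₂~ : CommuteUpTo (q F.* q) (g F₂) (g K₂)
  F₂K₂~ = flip-upTo q²q⁻²≈1 (q-commutator⇒upTo (rel K₂F₂q))

  -- The factors are interchanged because the presentation lists every commuting pair but F₁, E₂ in
  -- normal order, whereas a rule acts on the reverse order.
  commutator⇒upTo1 : ∀ {t u} → ⟦ t , u ⟧ ≈ sc F.0# → CommuteUpTo F.1# u t
  commutator⇒upTo1 eq = commute⇒upTo1 (sym (commutator⇒commute eq))

  K₁⁻~ : ∀ {a b t} → b F.* a F.≈ F.1# → CommuteUpTo a t (g K₁) → CommuteUpTo b t (g K₁⁻)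
  K₁⁻~ ba≈1 = invert-upTo ba≈1 (rel K₁-invʳ) (rel K₁-invˡ)

  K₂⁻~ : ∀ {a b t} → b F.* a F.≈ F.1# → CommuteUpTo a t (g K₂) → CommuteUpTo b t (g K₂⁻)
  K₂⁻~ ba≈1 = invert-upTo ba≈1 (rel K₂-invʳ) (rel K₂-invˡ)

  K₂K₁~ : CommuteUpTo F.1# (g K₂) (g K₁)
  K₂K₁~ = commutator⇒upTo1 (rel K₁K₂)

  K₂⁻K₁~ : CommuteUpTo F.1# (g K₂⁻) (g K₁)
  -- `K₂⁻~` inverts the right-hand factor; flipping before and after makes it act on the left-hand
  -- one.
  K₂⁻K₁~ = flip-upTo 1*1≈1 (K₂⁻~ 1*1≈1 (flip-upTo 1*1≈1 K₂K₁~))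

  -- Multiplying [E,F] = H/(q − q⁻¹) by (q − q⁻¹)² clears the denominator.
  FE-rule : ∀ {E F H : Term WGen} → ⟦ E , F ⟧ ≈ sc d⁻ ⊗ H →
            F ⊗ (sc d² ⊗ E) ≈ sc d² ⊗ E ⊗ F ⊖ (sc q ⊖ sc q⁻) ⊗ H
  FE-rule {E} {F} {H} eq = sym (begin
    sc d² ⊗ E ⊗ F ⊖ (sc q ⊖ sc q⁻) ⊗ H
      ≈⟨ +-cong (trans (⊗-assoc _ _ _) (*-congˡ EF≈)) (-‿cong (*-congʳ (sym (sc-sub q q⁻)))) ⟩
    sc d² ⊗ (F ⊗ E ⊕ sc d⁻ ⊗ H) ⊖ sc d ⊗ H
      ≈⟨ +-congʳ (trans (distribˡ _ _ _) (+-congˡ (sc-assoc d²d⁻≈d H))) ⟩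
    sc d² ⊗ (F ⊗ E) ⊕ sc d ⊗ H ⊖ sc d ⊗ H
      ≈⟨ trans (⊕-assoc _ _ _) (trans (+-congˡ (-‿inverseʳ _)) (+-identityʳ _)) ⟩
    sc d² ⊗ (F ⊗ E)
      ≈⟨ sc-pull d² F E ⟨
    F ⊗ (sc d² ⊗ E) ∎)
    where
    EF≈ : E ⊗ F ≈ F ⊗ E ⊕ sc d⁻ ⊗ H
    EF≈ = begin
      E ⊗ F                                ≈⟨ +-identityʳ _ ⟨
      E ⊗ F ⊕ sc F.0#                      ≈⟨ +-congˡ (trans (⊕-comm _ _) (⊕-inv (F ⊗ E))) ⟨
      E ⊗ F ⊕ (⊖ (F ⊗ E) ⊕ F ⊗ E)          ≈⟨ ⊕-assoc _ _ _ ⟨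
      ⟦ E , F ⟧ ⊕ F ⊗ E                    ≈⟨ +-congʳ eq ⟩
      sc d⁻ ⊗ H ⊕ F ⊗ E                    ≈⟨ ⊕-comm _ _ ⟩
      F ⊗ E ⊕ sc d⁻ ⊗ H                    ∎

  -- The rewriting rules of 𝔚_q.

  to : ∀ {t} a → t ≈ ⟪ a ⟫ → Maybe (Reduct t)
  to a eq = just (proj₁ (expand a) , trans eq (proj₂ (expand a)))

  to1 : ∀ {t} → t ≈ sc F.1# → Maybe (Reduct t)
  to1 eq = just (word [] , trans eq (word-correct []))

  swap : ∀ x y → CommuteUpTo F.1# (ρ x) (ρ y) → Maybe (Reduct (ρ x ⊗ ρ y))
  swap x y eq = to (var y :* var x) (trans eq (*-identityˡ _))

  swap⁺ : ∀ x y → CommuteUpTo (q F.* q) (ρ x) (ρ y) → Maybe (Reduct (ρ x ⊗ ρ y))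
  swap⁺ x y eq = to (var v :* var v :* (var y :* var x)) (trans eq (*-congʳ (sc-* q q)))

  swap⁻ : ∀ x y → CommuteUpTo (q⁻ F.* q⁻) (ρ x) (ρ y) → Maybe (Reduct (ρ x ⊗ ρ y))
  swap⁻ x y eq = to (var v⁻ :* var v⁻ :* (var y :* var x)) (trans eq (*-congʳ (sc-* q⁻ q⁻)))

  I-swap : ∀ x → CommuteUpTo F.1# (g x) (g I)
  I-swap x = commutator⇒upTo1 (rel (I-central x))

  sc-swap : ∀ a t → CommuteUpTo F.1# t (sc a)
  sc-swap a t = commute⇒upTo1 (sym (sc-central a t))

  scale² : ∀ {a t u} → CommuteUpTo a t u → CommuteUpTo a (sc d² ⊗ t) u
  scale² = scale-upTo d²

  scale²ʳ : ∀ {t u} → CommuteUpTo F.1# t u → CommuteUpTo F.1# t (sc d² ⊗ u)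
  scale²ʳ = flip-upTo 1*1≈1 ∘ scale² ∘ flip-upTo 1*1≈1

  -- Clauses are grouped by the right-hand letter and cover every pair out of normal order and every
  -- pair of mutual inverses. Only moving eᵢ to the left of fᵢ creates additional terms.
  rules : Rules
  -- Without this clause and the one for v⁻ v⁻, the general clauses below would swap a letter with
  -- itself until the step bound ran out.
  rules v   v   = nothing
  rules v⁻  v   = to1 (trans (sym (sc-* q⁻ q)) (sc-cong q⁻q≈1))
  rules x   v   = swap x v (sc-swap q (ρ x))
  rules v   v⁻  = to1 (trans (sym (sc-* q q⁻)) (sc-cong qq⁻≈1))
  rules v⁻  v⁻  = nothing
  rules x   v⁻  = swap x v⁻ (sc-swap q⁻ (ρ x))
  rules k₁  ι   = swap k₁ ι (I-swap K₁)
  rules k₁⁻ ι   = swap k₁⁻ ι (I-swap K₁⁻)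
  rules k₂  ι   = swap k₂ ι (I-swap K₂)
  rules k₂⁻ ι   = swap k₂⁻ ι (I-swap K₂⁻)
  rules e₁  ι   = swap e₁ ι (scale² (I-swap E₁))
  rules e₂  ι   = swap e₂ ι (scale² (I-swap E₂))
  rules f₁  ι   = swap f₁ ι (I-swap F₁)
  rules f₂  ι   = swap f₂ ι (I-swap F₂)
  rules k₁⁻ k₁  = to1 (rel K₁-invˡ)
  rules k₂  k₁  = swap k₂ k₁ K₂K₁~
  rules k₂⁻ k₁  = swap k₂⁻ k₁ K₂⁻K₁~
  rules e₁  k₁  = swap⁻ e₁ k₁ (scale² E₁K₁~)
  rules e₂  k₁  = swap e₂ k₁ (scale² (commutator⇒upTo1 (rel K₁E₂)))
  rules f₁  k₁  = swap⁺ f₁ k₁ F₁K₁~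
  rules f₂  k₁  = swap f₂ k₁ (commutator⇒upTo1 (rel K₁F₂))
  rules k₁  k₁⁻ = to1 (rel K₁-invʳ)
  rules k₂  k₁⁻ = swap k₂ k₁⁻ (K₁⁻~ 1*1≈1 K₂K₁~)
  rules k₂⁻ k₁⁻ = swap k₂⁻ k₁⁻ (K₁⁻~ 1*1≈1 K₂⁻K₁~)
  rules e₁  k₁⁻ = swap⁺ e₁ k₁⁻ (scale² (K₁⁻~ q²q⁻²≈1 E₁K₁~))
  rules e₂  k₁⁻ = swap e₂ k₁⁻ (scale² (K₁⁻~ 1*1≈1 (commutator⇒upTo1 (rel K₁E₂))))
  rules f₁  k₁⁻ = swap⁻ f₁ k₁⁻ (K₁⁻~ q⁻²q²≈1 F₁K₁~)
  rules f₂  k₁⁻ = swap f₂ k₁⁻ (K₁⁻~ 1*1≈1 (commutator⇒upTo1 (rel K₁F₂)))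
  rules k₂⁻ k₂  = to1 (rel K₂-invˡ)
  rules e₁  k₂  = swap e₁ k₂ (scale² (commutator⇒upTo1 (rel K₂E₁)))
  rules e₂  k₂  = swap⁻ e₂ k₂ (scale² E₂K₂~)
  rules f₁  k₂  = swap f₁ k₂ (commutator⇒upTo1 (rel K₂F₁))
  rules f₂  k₂  = swap⁺ f₂ k₂ F₂K₂~
  rules k₂  k₂⁻ = to1 (rel K₂-invʳ)
  rules e₁  k₂⁻ = swap e₁ k₂⁻ (scale² (K₂⁻~ 1*1≈1 (commutator⇒upTo1 (rel K₂E₁))))
  rules e₂  k₂⁻ = swap⁺ e₂ k₂⁻ (scale² (K₂⁻~ q²q⁻²≈1 E₂K₂~))
  rules f₁  k₂⁻ = swap f₁ k₂⁻ (K₂⁻~ 1*1≈1 (commutator⇒upTo1 (rel K₂F₁)))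
  rules f₂  k₂⁻ = swap⁻ f₂ k₂⁻ (K₂⁻~ q⁻²q²≈1 F₂K₂~)
  rules e₂  e₁  = swap e₂ e₁ (scale² (scale²ʳ (commutator⇒upTo1 (rel E₁E₂))))
  rules f₁  e₁  = to (var e₁ :* var f₁ :- (var v :- var v⁻) :* (var k₁ :- var ι :* var k₁⁻))
                     (FE-rule (rel E₁F₁))
  rules f₂  e₁  = swap f₂ e₁ (scale²ʳ (commutator⇒upTo1 (rel E₁F₂)))
  rules f₁  e₂  = swap f₁ e₂ (scale²ʳ (commute⇒upTo1 (commutator⇒commute (rel F₁E₂))))
  rules f₂  e₂  = to (var e₂ :* var f₂ :- (var v :- var v⁻) :* (var ι :* var k₂ :- var k₂⁻))
                     (FE-rule (rel E₂F₂))
  rules f₂  f₁  = swap f₂ f₁ (commutator⇒upTo1 (rel F₁F₂))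
  rules _   _   = nothing

  -- Identities among the images of the generators.

  img : HGen → Term WGen
  img A = imgA
  img B = imgB
  img C = imgC

  -- Products associate to the left, so (q - q⁻¹)² Eᵢ appears as the value of eᵢ and `αᵉ`, `βᵉ`,
  -- `γᵉ` evaluate definitionally to `imgα`, `imgβ`, `imgγ`.
  Λ₁ᵉ Λ₂ᵉ dᵉ αᵉ βᵉ γᵉ : Expr
  Λ₁ᵉ = var e₁ :* var f₁ :+ var v⁻ :* var k₁ :+ var v :* var ι :* var k₁⁻
  Λ₂ᵉ = var e₂ :* var f₂ :+ var v⁻ :* var ι :* var k₂ :+ var v :* var k₂⁻
  dᵉ  = var v :- var v⁻
  αᵉ  = Λ₂ᵉ :+ Λ₁ᵉ :* var k₁⁻ :* var k₂⁻
  βᵉ  = var ι :* var k₁⁻ :* var k₂⁻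
  γᵉ  = Λ₁ᵉ :+ Λ₂ᵉ :* var k₁⁻ :* var k₂⁻

  imgᵉ : HGen → Expr
  imgᵉ A = var k₂⁻
  imgᵉ B = (var e₁ :+ var k₁⁻ :* var e₂) :* (var f₁ :* var k₂ :+ var f₂)
           :+ var v⁻ :* var k₁ :* var k₂ :+ var v :* var k₁⁻ :* var k₂⁻
  imgᵉ C = var ι :* var k₁⁻ :- var v :* var e₁ :* var f₂ :* var k₂⁻

  -- For B the factor (q - q⁻¹)² has to be distributed and moved past K₁⁻¹ to meet E₂; for C the
  -- scalar q(q - q⁻¹)² has to be split.
  imgᵉ-correct : ∀ x → img x ≈ ⟪ imgᵉ x ⟫
  imgᵉ-correct A = refl
  imgᵉ-correct B = +-congʳ (+-congʳ (*-congʳ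
    (trans (distribˡ _ _ _) (+-congˡ (sym (sc-pull d² (g K₁⁻) (g E₂)))))))
  imgᵉ-correct C = +-congˡ (-‿cong (*-congʳ (*-congʳ (sym (sc-assoc F.refl (g E₁))))))

  ⟦_,_⟧qᵉ : Expr → Expr → Expr
  ⟦ a , b ⟧qᵉ = var v :* a :* b :- var v⁻ :* b :* a

  q-commutatorᵉ : ∀ x y → ⟦ img x , img y ⟧q ≈ ⟪ ⟦ imgᵉ x , imgᵉ y ⟧qᵉ ⟫
  q-commutatorᵉ x y = +-cong
    (*-cong (*-congˡ (imgᵉ-correct x)) (imgᵉ-correct y))
    (-‿cong (*-cong (*-congˡ (imgᵉ-correct y)) (imgᵉ-correct x)))

  d₂ᵉ : Expr
  d₂ᵉ = var v :* var v :- var v⁻ :* var v⁻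

  d₂ᵉ-correct : sc d₂ ≈ ⟪ d₂ᵉ ⟫
  d₂ᵉ-correct = trans (sc-sub _ _) (+-cong (sc-* q q) (-‿cong (sc-* q⁻ q⁻)))

  -- A form free of denominators, as the rewriting requires; dividing it by q² - q⁻² describes `P₁`,
  -- dividing by q - q⁻¹ describes α.
  α-identity : ⟦ imgB , imgC ⟧q ⊕ sc d₂ ⊗ imgA ≈ sc d ⊗ imgα
  α-identity = begin
    ⟦ imgB , imgC ⟧q ⊕ sc d₂ ⊗ imgA
      ≈⟨ +-cong (q-commutatorᵉ B C) (*-congʳ d₂ᵉ-correct) ⟩
    ⟪ ⟦ imgᵉ B , imgᵉ C ⟧qᵉ :+ d₂ᵉ :* imgᵉ A ⟫
      ≈⟨ prove rules (⟦ imgᵉ B , imgᵉ C ⟧qᵉ :+ d₂ᵉ :* imgᵉ A) (dᵉ :* αᵉ) ≡.refl ⟩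
    ⟪ dᵉ :* αᵉ ⟫
      ≈⟨ *-congʳ (sc-sub q q⁻) ⟨
    sc d ⊗ imgα ∎

  β-identity : ⟦ imgC , imgA ⟧q ≈ sc d ⊗ imgβ
  β-identity = begin
    ⟦ imgC , imgA ⟧q
      ≈⟨ q-commutatorᵉ C A ⟩
    ⟪ ⟦ imgᵉ C , imgᵉ A ⟧qᵉ ⟫
      ≈⟨ prove rules ⟦ imgᵉ C , imgᵉ A ⟧qᵉ (dᵉ :* βᵉ) ≡.refl ⟩
    ⟪ dᵉ :* βᵉ ⟫
      ≈⟨ *-congʳ (sc-sub q q⁻) ⟨
    sc d ⊗ imgβ ∎

  γ-identity : ⟦ imgA , imgB ⟧q ⊕ sc d₂ ⊗ imgC ≈ sc d ⊗ imgγ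
  γ-identity = begin
    ⟦ imgA , imgB ⟧q ⊕ sc d₂ ⊗ imgC
      ≈⟨ +-cong (q-commutatorᵉ A B) (*-cong d₂ᵉ-correct (imgᵉ-correct C)) ⟩
    ⟪ ⟦ imgᵉ A , imgᵉ B ⟧qᵉ :+ d₂ᵉ :* imgᵉ C ⟫
      ≈⟨ prove rules (⟦ imgᵉ A , imgᵉ B ⟧qᵉ :+ d₂ᵉ :* imgᵉ C) (dᵉ :* γᵉ) ≡.refl ⟩
    ⟪ dᵉ :* γᵉ ⟫
      ≈⟨ *-congʳ (sc-sub q q⁻) ⟨
    sc d ⊗ imgγ ∎

  commuteᵉ : ∀ z x → proj₁ (normalise rules (z :* imgᵉ x :- imgᵉ x :* z)) ≡ [] →
             ⟪ z ⟫ ⊗ img x ≈ img x ⊗ ⟪ z ⟫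
  commuteᵉ z x eq = begin
    ⟪ z ⟫ ⊗ img x       ≈⟨ *-congˡ (imgᵉ-correct x) ⟩
    ⟪ z :* imgᵉ x ⟫     ≈⟨ prove rules (z :* imgᵉ x) (imgᵉ x :* z) eq ⟩
    ⟪ imgᵉ x :* z ⟫     ≈⟨ *-congʳ (imgᵉ-correct x) ⟨
    img x ⊗ ⟪ z ⟫       ∎

  -- The relations of ℋ_q ask for commutation with the generators only, so three computations
  -- suffice.
  imgα-commutes : ∀ x → imgα ⊗ img x ≈ img x ⊗ imgα
  imgα-commutes A = commuteᵉ αᵉ A ≡.refl
  imgα-commutes B = commuteᵉ αᵉ B ≡.refl
  imgα-commutes C = commuteᵉ αᵉ C ≡.refl

  imgβ-commutes : ∀ x → imgβ ⊗ img x ≈ img x ⊗ imgβ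
  imgβ-commutes A = commuteᵉ βᵉ A ≡.refl
  imgβ-commutes B = commuteᵉ βᵉ B ≡.refl
  imgβ-commutes C = commuteᵉ βᵉ C ≡.refl

  imgγ-commutes : ∀ x → imgγ ⊗ img x ≈ img x ⊗ imgγ
  imgγ-commutes A = commuteᵉ γᵉ A ≡.refl
  imgγ-commutes B = commuteᵉ γᵉ B ≡.refl
  imgγ-commutes C = commuteᵉ γᵉ C ≡.refl

  -- The homomorphism, its uniqueness and its values on α, β, γ.

  ♮ : Term HGen → Term WGen
  ♮ = extend F.commutativeRing img

  -- Division by q² - q⁻², giving u the coefficient 1 that A and C have in `P₁` and `P₃`.
  rescale-P : ∀ {t u z} → t ⊕ sc d₂ ⊗ u ≈ sc d ⊗ z → sc d₂⁻ ⊗ t ⊕ u ≈ sc (d₂⁻ F.* d) ⊗ z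
  rescale-P {t} {u} {z} eq = begin
    sc d₂⁻ ⊗ t ⊕ u                 ≈⟨ +-congˡ (*-identityˡ u) ⟨
    sc d₂⁻ ⊗ t ⊕ sc F.1# ⊗ u       ≈⟨ sc-factor d₂⁻d₂≈1 t u ⟩
    sc d₂⁻ ⊗ (t ⊕ sc d₂ ⊗ u)       ≈⟨ *-congˡ eq ⟩
    sc d₂⁻ ⊗ (sc d ⊗ z)            ≈⟨ sc-assoc F.refl z ⟩
    sc (d₂⁻ F.* d) ⊗ z             ∎

  rescale-α : ∀ {t u z} → t ⊕ sc d₂ ⊗ u ≈ sc d ⊗ z → sc d⁻ ⊗ t ⊕ sc (q F.+ q⁻) ⊗ u ≈ z
  rescale-α {t} {u} {z} eq = begin
    sc d⁻ ⊗ t ⊕ sc (q F.+ q⁻) ⊗ u  ≈⟨ sc-factor d⁻d₂≈q+q⁻ t u ⟩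
    sc d⁻ ⊗ (t ⊕ sc d₂ ⊗ u)        ≈⟨ *-congˡ eq ⟩
    sc d⁻ ⊗ (sc d ⊗ z)             ≈⟨ sc-cancel d⁻d≈1 z ⟩
    z                              ∎

  -- Unfolding `extend` turns the image of each `P₁`, `P₂`, `P₃` into the left-hand side of a proved
  -- identity, hence into a multiple of `imgα`, `imgβ`, `imgγ`.
  ♮-relations : ∀ {s t} → HRel s t → ♮ s ≈ ♮ t
  ♮-relations (P₁-central x) = scaled-commutator _ (rescale-P α-identity) (imgα-commutes x)
  ♮-relations (P₂-central x) = scaled-commutator _ β-identity (imgβ-commutes x)
  ♮-relations (P₃-central x) = scaled-commutator _ (rescale-P γ-identity) (imgγ-commutes x)

  ♮-isHom : IsHomHW ♮
  ♮-isHom = extend-isHom F.commutativeRing img ♮-relations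

  ♮-unique : ∀ h → IsHomHW h → h 𝐀 ≈W imgA → h 𝐁 ≈W imgB → h 𝐂 ≈W imgC → ∀ t → h t ≈W ♮ t
  ♮-unique h hom hA hB hC =
    extend-unique F.commutativeRing img hom λ { A → hA ; B → hB ; C → hC }

  ♮α : ♮ α ≈W imgα
  ♮α = rescale-α α-identity

  ♮β : ♮ β ≈W imgβ
  ♮β = trans (*-congˡ β-identity) (sc-cancel d⁻d≈1 imgβ)

  ♮γ : ♮ γ ≈W imgγ
  ♮γ = rescale-α γ-identity

theorem5p2 : ∀ {c ℓ} (F : Field c ℓ) (q : Field.Carrier F)
    → ¬ (Field._≈_ F q (Field.0# F))
    → NotRootOfUnity F q
    → CharacteristicZero F
    → let open QHahn F q in
    Σ (Term HGen → Term WGen) λ f →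
    IsHomHW f
    × f 𝐀 ≈W imgA × f 𝐁 ≈W imgB × f 𝐂 ≈W imgC
    × (∀ (h : Term HGen → Term WGen) → IsHomHW h
    → h 𝐀 ≈W imgA → h 𝐁 ≈W imgB → h 𝐂 ≈W imgC
    → ∀ t → h t ≈W f t)
    × f α ≈W imgα × f β ≈W imgβ × f γ ≈W imgγ
theorem5p2 F q q≉0 q-generic _ =
  ♮ , ♮-isHom , refl , refl , refl , ♮-unique , ♮α , ♮β , ♮γ
  where
  open HahnToW F q q≉0 q-generic
  open Ring (Presented.presentedRing (Field.commutativeRing F) (QHahn.WRel F q)) using (refl)
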